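{- Let $t$ be a positive integer and let $P_n$ be the path on $n$ vertices with $n\ge 3$. Then $c\chi_2^t(P_n)=4$ if $t=1$, and $c\chi_2^t(P_n)=2$ if $t\ge 2$.
   Context: Graphs are finite, undirected and simple. For a positive integer $k$ and $i,j\in\{0,1,\dots,k-1\}$, the circular distance is $|i-j|_k=\min\{|i-j|,\,k-|i-j|\}$. For a nonnegative integer $t$, a $(\frac{k}{2},t)^*$-coloring of a graph $G$ is a mapping $f:V(G)\to\{0,1,\dots,k-1\}$ such that adjacent vertices receive different integers and, for each vertex $u$, the number of neighbors $v$ of $u$ with $|f(u)-f(v)|_k=1$ is at most $t$. $G$ is $(\frac{k}{2},t)^*$-colorable if it has such a coloring. (The symbol $\frac{k}{2}$ is formal notation recording the pair $(k,2)$, not a reduced fraction.) The $t$-relaxed 2-distant circular chromatic number $c\chi_2^t(G)$ is the minimum positive integer $k$ such that $G$ is $(\frac{k}{2},t)^*$-colorable. -}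

module Defs where

open import Data.Fin.Base using (Fin; toℕ)
open import Data.List.Base using (allFin; filter; length)
open import Data.Nat.Base using (ℕ; suc; _∸_; _⊓_; _≤_; ∣_-_∣)
open import Data.Nat.Properties using (_≟_; ≤-antisym; 1+n≢n)
open import Data.Product.Base using (∃)
open import Data.Sum.Base using (_⊎_; inj₁; inj₂; swap)
open import Level using (0ℓ)
open import Relation.Binary.Core using (Rel)
open import Relation.Binary.Definitions using (Decidable; Symmetric)
open import Relation.Binary.PropositionalEquality using (_≡_; _≢_)
open import Relation.Nullary.Decidable.Core using (_×-dec_; _⊎-dec_)
open import Relation.Nullary.Negation.Core using (¬_)

-- A finite simple graph with vertex set Fin n.  Adjacency is decidable so that
-- neighbours can be counted.
record Graph (n : ℕ) : Set₁ where
  field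
    Adj    : Rel (Fin n) 0ℓ
    adj?   : Decidable Adj
    symm   : Symmetric Adj
    irrefl : ∀ {u} → ¬ Adj u u

path : (n : ℕ) → Graph n
path n = record
  { Adj    = λ u v → suc (toℕ u) ≡ toℕ v ⊎ suc (toℕ v) ≡ toℕ u
  ; adj?   = λ u v → (suc (toℕ u) ≟ toℕ v) ⊎-dec (suc (toℕ v) ≟ toℕ u)
  ; symm   = swap
  ; irrefl = λ { (inj₁ e) → 1+n≢n e ; (inj₂ e) → 1+n≢n e }
  }

-- The truncated subtraction never truncates here, since ∣ i - j ∣ < k for
-- i and j in Fin k.
circDist : ∀ {k} → Fin k → Fin k → ℕ
circDist {k} i j = ∣ toℕ i - toℕ j ∣ ⊓ (k ∸ ∣ toℕ i - toℕ j ∣)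

module _ {n : ℕ} (G : Graph n) where
  open Graph G

  -- The number of neighbours v of u with |f(u) - f(v)|ₖ = 1.
  closeNeighbours : ∀ {k} → (Fin n → Fin k) → Fin n → ℕ
  closeNeighbours f u =
    length (filter (λ v → adj? u v ×-dec (circDist (f u) (f v) ≟ 1)) (allFin n))

  -- f is a (k/2, t)*-coloring of G.
  record IsColoring (k t : ℕ) (f : Fin n → Fin k) : Set where
    field
      proper  : ∀ {u v} → Adj u v → f u ≢ f v
      relaxed : ∀ u → closeNeighbours f u ≤ t

  Colorable : (k t : ℕ) → Set
  Colorable k t = ∃ λ (f : Fin n → Fin k) → IsColoring k t f

  -- cχ₂ᵗ(G) = k.  The minimum ranges over positive integers only: the empty
  -- graph would otherwise be colorable with k = 0.
  record Cχ₂ (t k : ℕ) : Set where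
    field
      positive  : 1 ≤ k
      colorable : Colorable k t
      minimal   : ∀ {m} → 1 ≤ m → Colorable m t → k ≤ m

  -- Hence Cχ₂ t k may be read as an equation determining k.
  Cχ₂-unique : ∀ {t k l} → Cχ₂ t k → Cχ₂ t l → k ≡ l
  Cχ₂-unique p q = ≤-antisym
    (minimal p (positive q) (colorable q))
    (minimal q (positive p) (colorable p))
    where open Cχ₂

{-# OPTIONS --safe #-}

-- For k ≤ 3 any two distinct colours are at circular distance 1, so both
-- neighbours of an inner vertex are close to it, which rules out t = 1.
-- Alternating 0, 2 modulo 4 leaves no close neighbours at all, while for t ≥ 2
-- the maximum degree 2 makes every proper coloring relaxed.
module Submission where

open import Defs
open import Data.Empty using (⊥)
open import Data.Fin using (Fin; zero; suc; toℕ; #_)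
open import Data.Fin.Properties using (toℕ-injective; all?) renaming (_≟_ to _≟ᶠ_)
open import Data.List.Base using (List; []; _∷_; allFin; filter; length)
open import Data.List.Membership.Propositional using (_∈_)
open import Data.List.Membership.Propositional.Properties using (∈-filter⁺; ∈-allFin)
open import Data.List.Properties using (filter-none)
open import Data.List.Relation.Unary.All as All using (All; []; _∷_)
open import Data.List.Relation.Unary.All.Properties using (all-filter)
open import Data.List.Relation.Unary.AllPairs.Core using ([]; _∷_)
open import Data.List.Relation.Unary.Any using (here)
open import Data.List.Relation.Unary.Unique.Propositional using (Unique)
open import Data.List.Relation.Unary.Unique.Propositional.Properties using (allFin⁺; filter⁺)
open import Data.Nat.Base using (ℕ; zero; suc; _∸_; _⊓_; _≤_; z≤n; s≤s)
open import Data.Nat.Properties using (_≟_; suc-injective; ≤-trans; ≤-reflexive; ≰⇒>; ∣-∣-comm)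
open import Data.Product.Base using (_×_; _,_; proj₁; proj₂)
open import Data.Sum.Base using (inj₁; inj₂)
open import Level using (0ℓ)
open import Relation.Binary.Core using (Rel)
open import Relation.Binary.Definitions using (Symmetric)
open import Relation.Binary.PropositionalEquality
  using (_≡_; _≢_; refl; sym; trans; cong; subst; ≢-sym)
open import Relation.Nullary.Decidable using (Dec; from-yes; ¬?; _×-dec_; _→-dec_)
open import Relation.Nullary.Negation using (contradiction)

-- Swapping the two values at each step, instead of testing parity, lets `alternate-step` go by
-- induction using only the symmetry of the relation.
alternate : {A : Set} → A → A → ℕ → A
alternate a b zero    = a
alternate a b (suc m) = alternate b a m

distinct-members : {A : Set} {x y : A} {xs : List A} →
  x ≢ y → x ∈ xs → y ∈ xs → 2 ≤ length xs
distinct-members {xs = _ ∷ _ ∷ _} _   _           _           = s≤s (s≤s z≤n)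
distinct-members {xs = _ ∷ []}    x≢y (here refl) (here refl) = contradiction refl x≢y

module _ {A : Set} {R : Rel A 0ℓ} (R-sym : Symmetric R) where

  alternate-step : ∀ {a b} → R a b → ∀ m → R (alternate a b m) (alternate a b (suc m))
  alternate-step r zero    = r
  alternate-step r (suc m) = alternate-step (R-sym r) m

  -- Kept general in `R` because it serves twice: with `_≢_` it gives properness, with distance
  -- other than 1 it shows that no neighbour is close.
  alternate-path : ∀ {a b n} → R a b → ∀ {u v} → Graph.Adj (path n) u v →
    R (alternate a b (toℕ u)) (alternate a b (toℕ v))
  alternate-path {a} {b} r {u} {v} (inj₁ e) =
    subst (λ m → R (alternate a b (toℕ u)) (alternate a b m)) e (alternate-step r (toℕ u))
  alternate-path {a} {b} r {u} {v} (inj₂ e) =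
    R-sym (subst (λ m → R (alternate a b (toℕ v)) (alternate a b m)) e (alternate-step r (toℕ v)))

module _ {n : ℕ} {u : Fin n} where
  open Graph (path n)

  successor-unique : ∀ {x y : Fin n} → suc (toℕ u) ≡ toℕ x → suc (toℕ u) ≡ toℕ y → x ≡ y
  successor-unique p q = toℕ-injective (trans (sym p) q)

  predecessor-unique : ∀ {x y : Fin n} → suc (toℕ x) ≡ toℕ u → suc (toℕ y) ≡ toℕ u → x ≡ y
  predecessor-unique p q = toℕ-injective (suc-injective (trans p (sym q)))

  -- Pigeonhole: each neighbour comes right after or right before `u`, so two of the three lie on
  -- the same side and coincide.
  no-three-neighbours : ∀ {x y z} → Adj u x → Adj u y → Adj u z →
    x ≢ y → x ≢ z → y ≢ z → ⊥
  no-three-neighbours (inj₁ p) (inj₁ q) _        x≢y _   _   = x≢y (successor-unique p q)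
  no-three-neighbours (inj₂ p) (inj₂ q) _        x≢y _   _   = x≢y (predecessor-unique p q)
  no-three-neighbours (inj₁ p) (inj₂ _) (inj₁ r) _   x≢z _   = x≢z (successor-unique p r)
  no-three-neighbours (inj₁ _) (inj₂ q) (inj₂ r) _   _   y≢z = y≢z (predecessor-unique q r)
  no-three-neighbours (inj₂ _) (inj₁ q) (inj₁ r) _   _   y≢z = y≢z (successor-unique q r)
  no-three-neighbours (inj₂ p) (inj₁ _) (inj₂ r) _   x≢z _   = x≢z (predecessor-unique p r)

  neighbours-length≤2 : ∀ {xs} → Unique xs → All (Adj u) xs → length xs ≤ 2
  neighbours-length≤2 {[]}         _ _ = z≤n
  neighbours-length≤2 {_ ∷ []}     _ _ = s≤s z≤n
  neighbours-length≤2 {_ ∷ _ ∷ []} _ _ = s≤s (s≤s z≤n)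
  neighbours-length≤2 {_ ∷ _ ∷ _ ∷ _}
    ((x≢y ∷ x≢z ∷ _) ∷ (y≢z ∷ _) ∷ _) (p ∷ q ∷ r ∷ _)
    with () ← no-three-neighbours p q r x≢y x≢z y≢z

module _ {n k : ℕ} (f : Fin n → Fin k) where

  module _ (G : Graph n) (u : Fin n) where
    open Graph G

    close? : (v : Fin n) → Dec (Adj u v × circDist (f u) (f v) ≡ 1)
    close? v = adj? u v ×-dec (circDist (f u) (f v) ≟ 1)

    closeNeighbours≡0 : (∀ {v} → Adj u v → circDist (f u) (f v) ≢ 1) →
      closeNeighbours G f u ≡ 0
    closeNeighbours≡0 far = cong length
      (filter-none close? (All.universal (λ _ (a , d) → far a d) (allFin n)))

  -- Close neighbours are in particular neighbours, and filtering `allFin n` lists none twice, so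
  -- the degree bound applies whatever `f` is.
  closeNeighbours-path≤2 : ∀ u → closeNeighbours (path n) f u ≤ 2
  closeNeighbours-path≤2 u = neighbours-length≤2
    (filter⁺ (close? (path n) u) (allFin⁺ n))
    (All.map proj₁ (all-filter (close? (path n) u) (allFin n)))

circDist-sym : ∀ {k} (i j : Fin k) → circDist i j ≡ circDist j i
circDist-sym {k} i j = cong (λ d → d ⊓ (k ∸ d)) (∣-∣-comm (toℕ i) (toℕ j))

-- A nonzero difference of colours is 1 or, when `k` is 3, possibly 2, which wraps around to 1.
-- Matching on the bound makes `k` a numeral, so the decision procedure can run over all pairs.
circDist≡1 : ∀ {k} → k ≤ 3 → (i j : Fin k) → i ≢ j → circDist i j ≡ 1
circDist≡1 z≤n                   = λ ()
circDist≡1 (s≤s z≤n)             = from-yes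
  (all? λ (i : Fin 1) → all? λ j → ¬? (i ≟ᶠ j) →-dec (circDist i j ≟ 1))
circDist≡1 (s≤s (s≤s z≤n))       = from-yes
  (all? λ (i : Fin 2) → all? λ j → ¬? (i ≟ᶠ j) →-dec (circDist i j ≟ 1))
circDist≡1 (s≤s (s≤s (s≤s z≤n))) = from-yes
  (all? λ (i : Fin 3) → all? λ j → ¬? (i ≟ᶠ j) →-dec (circDist i j ≟ 1))

module _ {m k t : ℕ} where

  private
    P : Graph (suc (suc (suc m)))
    P = path (suc (suc (suc m)))

  colours≥2 : Colorable P k t → 2 ≤ k
  colours≥2 (f , c) = distinct (f zero) (f (suc zero)) (IsColoring.proper c (inj₁ refl))
    where
    -- Two arbitrary colours replace those of the first edge, so that `l` can be split: `Fin 0` is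
    -- empty and `Fin 1` has a single element.
    distinct : ∀ {l} (i j : Fin l) → i ≢ j → 2 ≤ l
    distinct {suc (suc _)} _    _    _   = s≤s (s≤s z≤n)
    distinct {suc zero}    zero zero i≢j = contradiction refl i≢j

  fewColours⇒2≤t : k ≤ 3 → Colorable P k t → 2 ≤ t
  fewColours⇒2≤t k≤3 (f , c) = ≤-trans 2≤close (relaxed u)
    where
    open Graph P
    open IsColoring c

    u : Fin (suc (suc (suc m)))
    -- With at least three vertices, the second one is inner: its neighbours are the first and the
    -- third.
    u = suc zero

    close : ∀ {v} → Adj u v → Adj u v × circDist (f u) (f v) ≡ 1
    close a = a , circDist≡1 k≤3 _ _ (proper a)

    close∈ : ∀ {v} → Adj u v → v ∈ filter (close? f P u) (allFin _)
    close∈ {v} a = ∈-filter⁺ (close? f P u) (∈-allFin v) (close a)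

    2≤close : 2 ≤ closeNeighbours P f u
    2≤close = distinct-members {x = zero} {y = suc (suc zero)} (λ ())
      (close∈ (inj₂ refl)) (close∈ (inj₁ refl))

theorem2p1 : (t n : ℕ) → 1 ≤ t → 3 ≤ n →
    (t ≡ 1 → Cχ₂ (path n) t 4) × (2 ≤ t → Cχ₂ (path n) t 2)
-- Matching exposes `n` as three successors, the form that the lower bounds require.
theorem2p1 t n _ (s≤s (s≤s (s≤s z≤n))) = four , two
  where
  four : t ≡ 1 → Cχ₂ (path n) t 4
  four refl = record
    { positive  = s≤s z≤n
    ; colorable = f , record
      { proper  = alternate-path {R = _≢_} ≢-sym λ ()
      ; relaxed = λ u → ≤-trans (≤-reflexive (closeNeighbours≡0 f (path n) u far)) z≤n
      }
    -- At most three colours would force `2 ≤ 1`.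
    ; minimal   = λ _ c → ≰⇒> λ k≤3 → contradiction (fewColours⇒2≤t k≤3 c) λ { (s≤s ()) }
    }
    where
    f : Fin n → Fin 4
    -- 0 and 2 are antipodal modulo 4, at circular distance 2.
    f u = alternate (# 0) (# 2) (toℕ u)

    far : ∀ {u v} → Graph.Adj (path n) u v → circDist (f u) (f v) ≢ 1
    far = alternate-path {R = λ i j → circDist i j ≢ 1}
      (λ {i} {j} ij≢1 ji≡1 → ij≢1 (trans (circDist-sym i j) ji≡1)) λ ()

  two : 2 ≤ t → Cχ₂ (path n) t 2
  two 2≤t = record
    { positive  = s≤s z≤n
    ; colorable = f , record
      { proper  = alternate-path {R = _≢_} ≢-sym λ ()
      -- Modulo 2 every edge joins close vertices, so only the degree bounds the count.
      ; relaxed = λ u → ≤-trans (closeNeighbours-path≤2 f u) 2≤t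
      }
    ; minimal   = λ _ → colours≥2
    }
    where
    f : Fin n → Fin 2
    f u = alternate (# 0) (# 1) (toℕ u)
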